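{- Let $E$ be an Archimedean effect algebra fulfilling the condition (W+). Then every meager element of $E$ is the orthosum of a system of hypermeager elements of $E$.
   Context: An effect algebra is a partial algebra $(E;\oplus,0,1)$ with $0\neq 1$ and a partial binary operation $\oplus$ such that for all $x,y,z\in E$: (1) $x\oplus y=y\oplus x$ if $x\oplus y$ is defined; (2) $(x\oplus y)\oplus z=x\oplus(y\oplus z)$ if one side is defined; (3) for every $x$ there is a unique $y$ (denoted $x'$) with $x\oplus y=1$; (4) if $1\oplus x$ is defined then $x=0$. One writes $x\le y$ and $y\ominus x=z$ iff $x\oplus z$ is defined and equals $y$; $\le$ is a partial order. $E$ is Archimedean if for every nonzero $x\in E$ there is a greatest positive integer $n$ such that $nx=x\oplus\dots\oplus x$ ($n$ times) exists. A system $G=(x_\kappa)_{\kappa\in H}$ of not necessarily different elements of $E$ is orthogonal if for every finite subsystem $K$ of $G$ the sum $\bigoplus K$ exists (with $\bigoplus\emptyset=0$). Put $G^\oplus=\{\bigoplus K\mid K\subseteq G\text{ finite}\}$. The orthosum $\bigoplus G$ of an orthogonal system $G$ exists iff the supremum $\bigvee G^\oplus$ exists in $E$, and then $\bigoplus G=\bigvee G^\oplus$. $E$ fulfills the condition (W+) if for each orthogonal subset $A\subseteq E$ and each two upper bounds $u,v$ of $A^\oplus$ there exists an upper bound $w$ of $A^\oplus$ with $w\le u$ and $w\le v$. An element $x\in E$ is sharp if $x\wedge x'=0$; $\mathrm{S}(E)$ is the set of sharp elements. An element $x\in E$ is meager if $v\in\mathrm{S}(E)$ and $v\le x$ imply $v=0$.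 An element $x\in E$ is hypermeager if there is $y\in E$ with $x\le y$ and $x\le y'$. -}

module Defs where

open import Level using (Level; suc)
open import Data.Nat.Base using () renaming (_≤_ to _≤ℕ_)
open import Data.List.Base using (List; []; _∷_; map; replicate)
open import Data.List.Relation.Unary.Unique.Propositional using (Unique)
open import Data.Maybe using (Maybe; just; Is-just; _>>=_)
open import Data.Product using (∃; ∃-syntax; ∃!; _×_; proj₁)
open import Data.Refinement using (Refinement; value)
open import Relation.Binary.PropositionalEquality using (_≡_; _≢_)
open import Relation.Unary using (Pred)

-- The partial operation is Maybe-valued: x ⊕ y ≡ nothing means that x ⊕ y
-- is undefined.  The equation ⊕-assoc between Maybe values says that if one
-- side is defined then so is the other, and the two are equal.

record EffectAlgebra (ℓ : Level) : Set (suc ℓ) where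
  infixl 6 _⊕_
  infix  8 _′
  infix  4 _≤_
  field
    Carrier    : Set ℓ
    _⊕_        : Carrier → Carrier → Maybe Carrier
    0# 1#      : Carrier
    0≢1        : 0# ≢ 1#
    ⊕-comm     : ∀ {x y z} → x ⊕ y ≡ just z → y ⊕ x ≡ just z
    ⊕-assoc    : ∀ x y z → (x ⊕ y >>= λ s → s ⊕ z) ≡ (y ⊕ z >>= λ t → x ⊕ t)
    complement : ∀ x → ∃! _≡_ λ y → x ⊕ y ≡ just 1#
    zero-one   : ∀ {x} → Is-just (1# ⊕ x) → x ≡ 0#

  _′ : Carrier → Carrier
  x ′ = proj₁ (complement x)

  _≤_ : Carrier → Carrier → Set ℓ
  x ≤ y = ∃[ z ] x ⊕ z ≡ just y

  IsMeet : Carrier → Carrier → Carrier → Set ℓ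
  IsMeet x y m = m ≤ x × m ≤ y × (∀ z → z ≤ x → z ≤ y → z ≤ m)

  UpperBound : Pred Carrier ℓ → Pred Carrier ℓ
  UpperBound P u = ∀ a → P a → a ≤ u

  IsSupremum : Pred Carrier ℓ → Pred Carrier ℓ
  IsSupremum P s = UpperBound P s × (∀ u → UpperBound P u → s ≤ u)

  ⨁ : List Carrier → Maybe Carrier
  ⨁ []       = just 0#
  ⨁ (a ∷ as) = ⨁ as >>= λ s → a ⊕ s

  Archimedean : Set ℓ
  Archimedean = ∀ x → x ≢ 0# →
    ∃[ n ] 1 ≤ℕ n × Is-just (⨁ (replicate n x))
         × (∀ m → Is-just (⨁ (replicate m x)) → m ≤ℕ n)

  -- A system is a family g : H → Carrier.  A finite subsystem is given by a
  -- list of pairwise distinct indices, so that repeated elements of the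
  -- system are summed with their multiplicity.

  Orthogonal : {H : Set ℓ} → (H → Carrier) → Set ℓ
  Orthogonal {H} g = ∀ (K : List H) → Unique K → Is-just (⨁ (map g K))

  FiniteSums : {H : Set ℓ} → (H → Carrier) → Pred Carrier ℓ
  FiniteSums {H} g a = ∃[ K ] Unique K × ⨁ (map g K) ≡ just a

  IsOrthosum : {H : Set ℓ} → (H → Carrier) → Carrier → Set ℓ
  IsOrthosum g x = Orthogonal g × IsSupremum (FiniteSums g) x

  -- A subset regarded as the system of its elements.  Membership proofs in
  -- Refinement are irrelevant, so each element of A is indexed exactly once.

  elements : (A : Pred Carrier ℓ) → Refinement Carrier A → Carrier
  elements A = value

  W+ : Set (suc ℓ)
  W+ = ∀ (A : Pred Carrier ℓ) → Orthogonal (elements A) →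
    ∀ u v → UpperBound (FiniteSums (elements A)) u →
            UpperBound (FiniteSums (elements A)) v →
    ∃[ w ] UpperBound (FiniteSums (elements A)) w × w ≤ u × w ≤ v

  Sharp : Pred Carrier ℓ
  Sharp x = IsMeet x (x ′) 0#

  Meager : Pred Carrier ℓ
  Meager x = ∀ v → Sharp v → v ≤ x → v ≡ 0#

  Hypermeager : Pred Carrier ℓ
  Hypermeager x = ∃[ y ] x ≤ y × x ≤ y ′

-- By Zorn's lemma, choose a maximal set M of multiples kz of hypermeager
-- elements z such that all finite sums of M lie below x and M is saturated:
-- no a ∈ M can be added to M a second time without some sum leaving [0, x].
-- Saturation survives the enlargement of M, so it passes to unions of chains.
--
-- Let u be an upper bound of the finite sums of M.  By (W+) there is an upper
-- bound w ≤ x, u; write w ⊕ y = x.  If y ≠ 0, then y is not sharp, which gives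
-- a hypermeager z ≠ 0 below y that can be added to M.  As E is Archimedean,
-- some multiple kz can be added to M while 2kz cannot.  Then kz ∉ M since M is
-- saturated, and M ∪ {kz} is again saturated, against maximality.  So y = 0
-- and x = w ≤ u: x is the orthosum of M.  Splitting each kz ∈ M into k copies
-- of z gives the required system.  Saturation is what allows (W+), which
-- speaks of sets only, to yield a system with repetitions.

module Submission where

open import Defs
open import Level using (Level; Lift; lift; lower; 0ℓ)
open import Algebra.Bundles using (CommutativeMonoid)
import Algebra.Properties.CommutativeSemigroup as CommutativeSemigroupProperties
open import Axiom.ExcludedMiddle using (ExcludedMiddle)
open import Axiom.Extensionality.Propositional using (Extensionality)
open import Data.Bool.Base using (Bool; true; false; T)
open import Data.Fin.Base using (Fin)
open import Data.Irrelevant using ([_])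
open import Data.List.Base using (List; []; _∷_; _++_; map; replicate; tabulate; concatMap; deduplicate)
open import Data.List.Properties using (map-++; map-tabulate)
open import Data.List.Membership.Propositional using (_∈_)
open import Data.List.Membership.Propositional.Properties
  using (∈-∃++; ∈-tabulate⁺; ∈-tabulate⁻; ∈-concatMap⁺; ∈-deduplicate⁺; ∈-map⁺)
open import Data.List.Relation.Binary.Disjoint.Propositional using (Disjoint)
open import Data.List.Relation.Binary.Permutation.Propositional using (_↭_; refl; prep; swap; ↭-trans)
open import Data.List.Relation.Binary.Permutation.Propositional.Properties using (shift; ∈-resp-↭; All-resp-↭)
  renaming (map⁺ to ↭-map⁺)
open import Data.List.Relation.Unary.All as All using (All; []; _∷_)
import Data.List.Relation.Unary.All.Properties as All
open import Data.List.Relation.Unary.AllPairs as AllPairs using ([]; _∷_)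
import Data.List.Relation.Unary.AllPairs.Properties as AllPairs
open import Data.List.Relation.Unary.Any as Any using (here; there)
open import Data.List.Relation.Unary.Unique.Propositional using (Unique)
open import Data.List.Relation.Unary.Unique.Propositional.Properties using (map⁺; map⁻; concat⁺; tabulate⁺)
import Data.List.Relation.Unary.Unique.DecPropositional.Properties as DecUnique
open import Data.Maybe using (Maybe; just; nothing; Is-just; _>>=_)
open import Data.Maybe.Properties using (just-injective)
open import Data.Maybe.Relation.Unary.Any using (just)
open import Data.Nat.Base as ℕ using (ℕ; zero; suc; _+_)
import Data.Nat.Properties as ℕ
open import Data.Product using (Σ-syntax; ∃-syntax; _×_; _,_; proj₁; proj₂)
open import Data.Refinement using (Refinement; value; _,_)
open import Data.Sum.Base using (_⊎_; inj₁; inj₂)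
open import Data.Unit.Base using (tt)
open import Function.Base using (_∘_)
open import Relation.Binary.PropositionalEquality
open import Relation.Nullary using (Dec; yes; no; ¬_; isYes; contradiction)
open import Relation.Nullary.Decidable using (decidable-stable; toWitness; fromWitness; recompute)
open import Relation.Unary using (Pred)

-- Zorn's lemma for Boolean-valued subsets

module MaximalSubsets {ℓ} (em : ExcludedMiddle ℓ) (ext : Extensionality ℓ 0ℓ) (I : Set ℓ) where

  -- Boolean-valued subsets stay in the universe ℓ, so that unions of
  -- arbitrary families of subsets exist.

  Subset : Set ℓ
  Subset = I → Bool

  infix 4 _⊆_
  _⊆_ : Subset → Subset → Set ℓ
  S ⊆ S′ = ∀ {i} → T (S i) → T (S′ i)

  ⟨_⟩ : {X : Set ℓ} → Pred X ℓ → X → Bool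
  ⟨ P ⟩ i = isYes (em {P i})

  ⋃ : (Subset → Bool) → Subset
  ⋃ F = ⟨ (λ i → ∃[ S ] T (F S) × T (S i)) ⟩

  insert : I → Subset → Subset
  insert i S = ⟨ (λ j → T (S j) ⊎ j ≡ i) ⟩

  Chain : (Subset → Bool) → Set ℓ
  Chain F = ∀ {S S′} → T (F S) → T (F S′) → S ⊆ S′ ⊎ S′ ⊆ S

  ⊆-antisym : ∀ {S S′} → S ⊆ S′ → S′ ⊆ S → S ≡ S′
  ⊆-antisym {S} {S′} p q = ext λ i → equal (S i) (S′ i) p q
    where
    equal : ∀ b c → (T b → T c) → (T c → T b) → b ≡ c
    equal true  true  _ _ = refl
    equal true  false f _ = contradiction (f tt) λ ()
    equal false true  _ g = contradiction (g tt) λ ()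
    equal false false _ _ = refl

  ⊆-insert : ∀ {i S} → S ⊆ insert i S
  ⊆-insert p = fromWitness (inj₁ p)

  ⊆-⋃ : ∀ {F S} → T (F S) → S ⊆ ⋃ F
  ⊆-⋃ S∈F i∈S = fromWitness (_ , S∈F , i∈S)

  insert-split : ∀ {i S K} → Unique K → All (T ∘ insert i S) K →
    All (T ∘ S) K ⊎ (∃[ K′ ] K ↭ i ∷ K′ × Unique K′ × All (T ∘ S) K′)
  insert-split [] [] = inj₁ []
  insert-split {i} {S} (k∉K ∷ K!) (k∈ ∷ K⊆) with toWitness k∈ | insert-split {i} {S} K! K⊆
  ... | inj₁ k∈S  | inj₁ K⊆S = inj₁ (k∈S ∷ K⊆S)
  ... | inj₂ refl | inj₁ K⊆S = inj₂ (_ , refl , K! , K⊆S)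
  -- Here `i` would occur twice in a list without repetitions.
  ... | inj₂ refl | inj₂ (K′ , K↭ , _) = contradiction refl (All.head (All-resp-↭ K↭ k∉K))
  ... | inj₁ k∈S  | inj₂ (K′ , K↭ , K′! , K′⊆S) =
    inj₂ (_ , ↭-trans (prep _ K↭) (swap _ _ refl) , All.tail (All-resp-↭ K↭ k∉K) ∷ K′! , k∈S ∷ K′⊆S)

  -- `S₀` serves the empty list; each further entry keeps the larger of two comparable members of
  -- the chain.
  chain-absorbs-finite : ∀ {F S₀ K} → Chain F → T (F S₀) → All (T ∘ ⋃ F) K →
    ∃[ S ] T (F S) × All (T ∘ S) K
  chain-absorbs-finite chain S₀∈F [] = _ , S₀∈F , []
  chain-absorbs-finite chain S₀∈F (k∈ ∷ K⊆)
    with toWitness k∈ | chain-absorbs-finite chain S₀∈F K⊆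
  ... | S , S∈F , k∈S | S′ , S′∈F , K⊆S′ with chain S∈F S′∈F
  ... | inj₁ S⊆S′ = S′ , S′∈F , S⊆S′ k∈S ∷ K⊆S′
  ... | inj₂ S′⊆S = S , S∈F , k∈S ∷ All.map S′⊆S K⊆S′

  module Zorn (P : Pred Subset ℓ)
    (⋃-closed : ∀ F → Chain F → (∀ {S} → T (F S) → P S) → P (⋃ F)) where

    Extendable : Pred Subset ℓ
    Extendable S = ∃[ i ] ¬ T (S i) × P (insert i S)

    -- Deciding `Extendable S` by excluded middle also yields a witness `i`, so this acts as a
    -- choice function.
    next : Subset → Subset
    next S with em {Extendable S}
    ... | yes (i , _) = insert i S
    ... | no  _       = S

    ⊆-next : ∀ S → S ⊆ next S
    ⊆-next S with em {Extendable S}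
    ... | yes (i , _) = ⊆-insert {i} {S}
    ... | no  _       = λ p → p

    next-preserves : ∀ {S} → P S → P (next S)
    next-preserves {S} pS with em {Extendable S}
    ... | yes (_ , _ , p) = p
    ... | no  _           = pS

    next-fixed : ∀ {S} → next S ⊆ S → ¬ Extendable S
    next-fixed {S} next⊆ extendable with em {Extendable S}
    ... | yes (i , i∉S , _) = i∉S (next⊆ (fromWitness (inj₂ refl)))
    ... | no  ¬extendable   = ¬extendable extendable

    -- The tower of the Bourbaki-Witt argument. It starts at the empty set, which is the union of
    -- the empty family.
    data Tower : Pred Subset ℓ where
      step  : ∀ {S} → Tower S → Tower (next S)
      union : ∀ F → (∀ {S} → T (F S) → Tower S) → Tower (⋃ F)

    -- Induction on both derivations. The strong alternative `next S′ ⊆ S` carries the step case: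
    -- comparing `S` and `S′` in both orders settles it or gives `S ≡ S′`, whence
    -- `next S′ ⊆ next S`.
    compare : ∀ {S S′} → Tower S → Tower S′ → S ⊆ S′ ⊎ next S′ ⊆ S
    compare {S′ = S′} (union F t) t′ with em {∃[ S ] T (F S) × ¬ (S ⊆ S′)}
    ... | no none = inj₁ λ i∈⋃ → let S , S∈F , i∈S = toWitness i∈⋃ in
          decidable-stable em (λ S⊈S′ → none (S , S∈F , S⊈S′)) i∈S
    ... | yes (S , S∈F , S⊈S′) with compare (t S∈F) t′
    ...   | inj₁ S⊆S′ = contradiction (λ {i} → S⊆S′ {i}) S⊈S′
    ...   | inj₂ next⊆S = inj₂ (⊆-⋃ {F} S∈F ∘ next⊆S)
    compare {S′ = S′} (step {S} t) t′ with compare t t′ | compare t′ t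
    ... | inj₂ next⊆S | _ = inj₂ (⊆-next S ∘ next⊆S)
    ... | inj₁ _ | inj₂ next⊆S′ = inj₁ next⊆S′
    ... | inj₁ S⊆S′ | inj₁ S′⊆S with ⊆-antisym {S} {S′} S⊆S′ S′⊆S
    ...   | refl = inj₂ λ p → p

    tower-chain : ∀ F → (∀ {S} → T (F S) → Tower S) → Chain F
    tower-chain F t {S} {S′} S∈F S′∈F with compare (t S∈F) (t S′∈F)
    ... | inj₁ S⊆S′   = inj₁ S⊆S′
    ... | inj₂ next⊆S = inj₂ (next⊆S ∘ ⊆-next S′)

    tower-satisfies : ∀ {S} → Tower S → P S
    tower-satisfies (step t)    = next-preserves (tower-satisfies t)
    tower-satisfies (union F t) = ⋃-closed F (tower-chain F t) (λ S∈F → tower-satisfies (t S∈F))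

    maximal : ∃[ M ] P M × ¬ Extendable M
    -- `top` is in the tower, hence so is `next top`, which is therefore contained in the union
    -- `top`.
    maximal = top , tower-satisfies top-tower , next-fixed (⊆-⋃ {⟨ Tower ⟩} (fromWitness (step top-tower)))
      where
      top : Subset
      top = ⋃ ⟨ Tower ⟩

      top-tower : Tower top
      top-tower = union ⟨ Tower ⟩ toWitness

-- Lists without repetitions and a doubling argument

tabulate-const : ∀ {a} {A : Set a} n (x : A) → tabulate {n = n} (λ _ → x) ≡ replicate n x
tabulate-const zero    x = refl
tabulate-const (suc n) x = cong (x ∷_) (tabulate-const n x)

replicate-+ : ∀ {a} {A : Set a} m n (x : A) → replicate (m + n) x ≡ replicate m x ++ replicate n x
replicate-+ zero    n x = refl
replicate-+ (suc m) n x = cong (x ∷_) (replicate-+ m n x)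

-- Each entry of `K` is pulled to the front of `L` and removed; as it does not recur in `K`, the
-- later entries are still found in what remains.
unique-⊆⇒↭-++ : ∀ {a} {A : Set a} {K L : List A} → Unique K → (∀ {i} → i ∈ K → i ∈ L) →
  ∃[ R ] L ↭ K ++ R
unique-⊆⇒↭-++ {L = L} [] _ = L , refl
unique-⊆⇒↭-++ {K = k ∷ K} (k∉K ∷ K!) K⊆L with ∈-∃++ (K⊆L (here refl))
... | ys , zs , refl = R , ↭-trans L↭ (prep k rest↭)
  where
  L↭ = shift k ys zs

  K⊆rest : ∀ {i} → i ∈ K → i ∈ ys ++ zs
  K⊆rest i∈K with ∈-resp-↭ L↭ (K⊆L (there i∈K))
  ... | here refl = contradiction refl (All.lookup k∉K i∈K)
  ... | there i∈  = i∈

  R = proj₁ (unique-⊆⇒↭-++ K! K⊆rest)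
  rest↭ = proj₂ (unique-⊆⇒↭-++ K! K⊆rest)

-- Doubling raises a positive `k` by at least one, so `Q` cannot survive repeated doubling past the
-- bound `N`.
doubling-fails : ∀ {ℓ} → ExcludedMiddle ℓ → {Q : ℕ → Set ℓ} (N : ℕ) → (∀ k → Q k → k ℕ.≤ N) →
  ∀ k → 1 ℕ.≤ k → Q k → ∃[ n ] Q n × ¬ Q (n + n)
doubling-fails em {Q} N bound k 1≤k Qk = search (suc N) k 1≤k (ℕ.m≤m+n (suc N) k) Qk
  where
  -- By the invariant `N < fuel + k`, `k` exceeds `N` once the fuel is used up.
  search : ∀ fuel k → 1 ℕ.≤ k → suc N ℕ.≤ fuel + k → Q k → ∃[ n ] Q n × ¬ Q (n + n)
  search zero k _ N<k Qk = contradiction (bound k Qk) (ℕ.<⇒≱ N<k)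
  search (suc fuel) k 1≤k N<fuel+k Qk with em {Q (k + k)}
  ... | no ¬Q2k = k , Qk , ¬Q2k
  ... | yes Q2k = search fuel (k + k) (ℕ.≤-trans 1≤k (ℕ.m≤m+n k k))
    (ℕ.≤-trans N<fuel+k (ℕ.≤-trans (ℕ.≤-reflexive (sym (ℕ.+-suc fuel k)))
      (ℕ.+-monoʳ-≤ fuel (ℕ.+-monoˡ-≤ k 1≤k)))) Q2k

-- Partial sums in an effect algebra

module Sums {ℓ} (E : EffectAlgebra ℓ) where
  open EffectAlgebra E

  one-zero : 1# ⊕ 0# ≡ just 1#
  one-zero with complement 1#
  ... | y , 1⊕y , _ with zero-one (subst Is-just (sym 1⊕y) (just tt))
  ...   | refl = 1⊕y

  -- By associativity `x ′ ⊕ (x ⊕ 0#)` equals `1# ⊕ 0#`, that is `1#`. So `x ⊕ 0#` is defined and,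
  -- like `x`, is the unique complement of `x ′`.
  ⊕-identityʳ : ∀ x → x ⊕ 0# ≡ just x
  ⊕-identityʳ x with x ⊕ 0# | ⊕-assoc (x ′) x 0#
  ... | r | assoc rewrite ⊕-comm (proj₁ (proj₂ (complement x))) | one-zero with r
  ...   | just t  = cong just (trans (sym (x″-unique (sym assoc))) (x″-unique (⊕-comm (proj₁ (proj₂ (complement x))))))
    where
    x″-unique : ∀ {y} → x ′ ⊕ y ≡ just 1# → x ′ ′ ≡ y
    x″-unique = proj₂ (proj₂ (complement (x ′)))

  infixl 6 _⊞_
  -- With `nothing` absorbing, the partial sum becomes a total commutative monoid, and sums can be
  -- rearranged before their existence is known.
  _⊞_ : Maybe Carrier → Maybe Carrier → Maybe Carrier
  m ⊞ n = m >>= λ s → n >>= λ t → s ⊕ t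

  ⊞-nothing : ∀ m → m ⊞ nothing ≡ nothing
  ⊞-nothing nothing  = refl
  ⊞-nothing (just _) = refl

  ⊞-comm : ∀ m n → m ⊞ n ≡ n ⊞ m
  ⊞-comm nothing  n        = sym (⊞-nothing n)
  ⊞-comm (just a) nothing  = refl
  ⊞-comm (just a) (just b) with a ⊕ b in ab | b ⊕ a in ba
  ... | just _  | _       = trans (sym (⊕-comm ab)) ba
  ... | nothing | nothing = refl
  ... | nothing | just _  = trans (sym ab) (⊕-comm ba)

  ⊞-assoc : ∀ l m n → (l ⊞ m) ⊞ n ≡ l ⊞ (m ⊞ n)
  ⊞-assoc nothing  m        n        = refl
  ⊞-assoc (just a) nothing  n        = refl
  ⊞-assoc (just a) (just b) nothing  = ⊞-nothing (a ⊕ b)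
  ⊞-assoc (just a) (just b) (just c) = ⊕-assoc a b c

  ⊞-identityʳ : ∀ m → m ⊞ just 0# ≡ m
  ⊞-identityʳ nothing  = refl
  ⊞-identityʳ (just a) = ⊕-identityʳ a

  ⊞-identityˡ : ∀ m → just 0# ⊞ m ≡ m
  ⊞-identityˡ m = trans (⊞-comm (just 0#) m) (⊞-identityʳ m)

  ⊞-commutativeMonoid : CommutativeMonoid ℓ ℓ
  ⊞-commutativeMonoid = record
    { _∙_ = _⊞_
    ; ε   = just 0#
    ; isCommutativeMonoid = record
      { isMonoid = record
        { isSemigroup = record
          { isMagma = record { isEquivalence = isEquivalence ; ∙-cong = cong₂ _⊞_ }
          ; assoc   = ⊞-assoc
          }
        ; identity = ⊞-identityˡ , ⊞-identityʳ
        }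
      ; comm = ⊞-comm
      }
    }

  open CommutativeSemigroupProperties (CommutativeMonoid.commutativeSemigroup ⊞-commutativeMonoid)
    using (x∙yz≈y∙xz; interchange)

  ⨁-++ : ∀ K L → ⨁ (K ++ L) ≡ ⨁ K ⊞ ⨁ L
  ⨁-++ []      L = sym (⊞-identityˡ (⨁ L))
  ⨁-++ (a ∷ K) L = trans (cong (just a ⊞_) (⨁-++ K L)) (sym (⊞-assoc (just a) (⨁ K) (⨁ L)))

  ⨁-↭ : ∀ {K L} → K ↭ L → ⨁ K ≡ ⨁ L
  ⨁-↭ refl                 = refl
  ⨁-↭ (prep a p)           = cong (just a ⊞_) (⨁-↭ p)
  ⨁-↭ {L = _ ∷ _ ∷ L} (swap a b p) rewrite ⨁-↭ p = x∙yz≈y∙xz (just a) (just b) (⨁ L)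
  ⨁-↭ (_↭_.trans p q)       = trans (⨁-↭ p) (⨁-↭ q)

  infix 4 _⊑_
  -- Divisibility in this monoid, with `nothing` on top: `m ⊑ just b` asserts at once that `m` is
  -- defined and that it lies below `b`.
  record _⊑_ (m n : Maybe Carrier) : Set ℓ where
    constructor _,_
    field
      rest : Maybe Carrier
      sum  : m ⊞ rest ≡ n

  ⊑-trans : ∀ {l m n} → l ⊑ m → m ⊑ n → l ⊑ n
  ⊑-trans {l} (r , refl) (s , refl) = r ⊞ s , sym (⊞-assoc l r s)

  ⊞-mono-⊑ : ∀ {k l m n} → k ⊑ m → l ⊑ n → k ⊞ l ⊑ m ⊞ n
  ⊞-mono-⊑ {k} {l} (r , refl) (s , refl) = r ⊞ s , interchange k l r s

  ≤⇒⊑ : ∀ {a b} → a ≤ b → just a ⊑ just b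
  ≤⇒⊑ (c , eq) = just c , eq

  ⊑⇒≤ : ∀ {m b} → m ⊑ just b → ∃[ a ] m ≡ just a × a ≤ b
  ⊑⇒≤ {just a} (just c , eq) = a , refl , c , eq

  just-⊑⇒≤ : ∀ {a b} → just a ⊑ just b → a ≤ b
  just-⊑⇒≤ (just c , eq) = c , eq

  ≤-trans : ∀ {a b c} → a ≤ b → b ≤ c → a ≤ c
  ≤-trans p q = just-⊑⇒≤ (⊑-trans (≤⇒⊑ p) (≤⇒⊑ q))

  zero-⊑ : ∀ m → just 0# ⊑ m
  zero-⊑ m = m , ⊞-identityˡ m

  ⨁-sublist-⊑ : ∀ K R {L} → L ↭ K ++ R → ⨁ K ⊑ ⨁ L
  ⨁-sublist-⊑ K R p = ⨁ R , sym (trans (⨁-↭ p) (⨁-++ K R))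

  ⊑-Is-just : ∀ {m b} → m ⊑ just b → Is-just m
  ⊑-Is-just {just _} _ = just tt

  Is-just⇒≡ : ∀ {m : Maybe Carrier} → Is-just m → ∃[ a ] m ≡ just a
  Is-just⇒≡ {just a} _ = a , refl

  -- Splitting each summand into copies

  module Splitting (em : ExcludedMiddle ℓ) {J : Set ℓ} (e z : J → Carrier) (k : J → ℕ)
    (split : ∀ j → ⨁ (replicate (k j) (z j)) ≡ just (e j)) where

    Copies : Set ℓ
    Copies = Σ[ j ∈ J ] Fin (k j)

    copy : Copies → Carrier
    copy = z ∘ proj₁

    block : J → List Copies
    block j = tabulate {n = k j} (j ,_)

    expand : List J → List Copies
    expand = concatMap block

    ⨁-block : ∀ j → ⨁ (map copy (block j)) ≡ just (e j)
    ⨁-block j = begin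
      ⨁ (map copy (block j))              ≡⟨ cong ⨁ (map-tabulate (j ,_) copy) ⟩
      ⨁ (tabulate {n = k j} (λ _ → z j))  ≡⟨ cong ⨁ (tabulate-const (k j) (z j)) ⟩
      ⨁ (replicate (k j) (z j))           ≡⟨ split j ⟩
      just (e j)                          ∎
      where open ≡-Reasoning

    ⨁-expand : ∀ K → ⨁ (map copy (expand K)) ≡ ⨁ (map e K)
    ⨁-expand []      = refl
    ⨁-expand (j ∷ K) = begin
      ⨁ (map copy (block j ++ expand K))                 ≡⟨ cong ⨁ (map-++ copy (block j) (expand K)) ⟩
      ⨁ (map copy (block j) ++ map copy (expand K))      ≡⟨ ⨁-++ (map copy (block j)) _ ⟩
      ⨁ (map copy (block j)) ⊞ ⨁ (map copy (expand K))  ≡⟨ cong₂ _⊞_ (⨁-block j) (⨁-expand K) ⟩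
      just (e j) ⊞ ⨁ (map e K)                           ∎
      where open ≡-Reasoning

    block-disjoint : ∀ {i j} → i ≢ j → Disjoint (block i) (block j)
    block-disjoint i≢j (p , q) =
      i≢j (cong proj₁ (trans (sym (proj₂ (∈-tabulate⁻ p))) (proj₂ (∈-tabulate⁻ q))))

    expand-unique : ∀ {K} → Unique K → Unique (expand K)
    expand-unique {K} K! = concat⁺
      (All.map⁺ (All.universal (λ j → tabulate⁺ λ { refl → refl }) K))
      (AllPairs.map⁺ (AllPairs.map (λ i≢j {_} → block-disjoint i≢j) K!))

    infix 4 _≟_
    _≟_ : (i j : J) → Dec (i ≡ j)
    i ≟ j = em

    support : List Copies → List J
    support K = deduplicate _≟_ (map proj₁ K)

    ∈-expand-support : ∀ {K c} → c ∈ K → c ∈ expand (support K)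
    ∈-expand-support {c = j , i} c∈K = ∈-concatMap⁺ block
      (Any.map (λ { refl → ∈-tabulate⁺ i }) (∈-deduplicate⁺ _≟_ (∈-map⁺ proj₁ c∈K)))

    -- Distinct copies are among all the copies of the indices they involve, and a sum over a part
    -- divides the whole sum.
    copies-⊑-support : ∀ {K} → Unique K → ⨁ (map copy K) ⊑ ⨁ (map e (support K))
    copies-⊑-support {K} K! with unique-⊆⇒↭-++ K! ∈-expand-support
    ... | R , p = subst (⨁ (map copy K) ⊑_) (⨁-expand (support K))
      (⨁-sublist-⊑ (map copy K) (map copy R) (subst (map copy (expand (support K)) ↭_) (map-++ copy K R) (↭-map⁺ copy p)))

    -- The finite sums of `e` are finite sums of copies and are cofinal among them, so both systems
    -- have the same upper bounds.
    split-orthosum : ∀ {x} → IsOrthosum e x → IsOrthosum copy x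
    split-orthosum {x} (orth , upper , least) = orth′ , upper′ , least′
      where
      copies-⊑ : ∀ {K} → Unique K → ⨁ (map copy K) ⊑ just x
      copies-⊑ {K} K! with Is-just⇒≡ (orth (support K) (DecUnique.deduplicate-! _≟_ _))
      ... | s , eq = ⊑-trans (subst (⨁ (map copy K) ⊑_) eq (copies-⊑-support K!))
        (≤⇒⊑ (upper s (support K , DecUnique.deduplicate-! _≟_ _ , eq)))

      orth′ : Orthogonal copy
      orth′ K K! = ⊑-Is-just (copies-⊑ K!)

      upper′ : UpperBound (FiniteSums copy) x
      upper′ a (K , K! , eq) = just-⊑⇒≤ (subst (_⊑ just x) eq (copies-⊑ K!))

      least′ : ∀ u → UpperBound (FiniteSums copy) u → x ≤ u
      least′ u bound = least u λ a (K , K! , eq) →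
        bound a (expand K , expand-unique K! , trans (⨁-expand K) eq)

-- Saturated sets of hypermeager multiples

module Construction {ℓ} (em : ExcludedMiddle ℓ) (ext : Extensionality ℓ 0ℓ) (E : EffectAlgebra ℓ)
  (x : EffectAlgebra.Carrier E) where
  open EffectAlgebra E
  open Sums E
  open MaximalSubsets em ext Carrier

  HypermeagerMultiple : Pred Carrier ℓ
  HypermeagerMultiple a = ∃[ z ] ∃[ k ] Hypermeager z × ⨁ (replicate k z) ≡ just a

  -- Taking `m` in `Maybe` covers sums such as `just a ⊞ just a`; an undefined `m` is never addable,
  -- as the empty `K` shows.
  Addable : Maybe Carrier → Subset → Set ℓ
  Addable m S = ∀ K → Unique K → All (T ∘ S) K → m ⊞ ⨁ K ⊑ just x

  record Admissible (S : Subset) : Set ℓ where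
    field
      multiples : ∀ {a} → T (S a) → HypermeagerMultiple a
      bounded   : ∀ {K} → Unique K → All (T ∘ S) K → ⨁ K ⊑ just x
      saturated : ∀ {a} → T (S a) → ¬ Addable (just a) S
  open Admissible

  Addable-antitone : ∀ m {S S′} → S ⊆ S′ → Addable m S′ → Addable m S
  Addable-antitone m S⊆S′ add K K! K⊆S = add K K! (All.map S⊆S′ K⊆S)

  Addable-⊑ : ∀ {m S} → Addable m S → m ⊑ just x
  Addable-⊑ {m} add = subst (_⊑ just x) (⊞-identityʳ m) (add [] [] [])

  ⋃-admissible : ∀ F → Chain F → (∀ {S} → T (F S) → Admissible S) → Admissible (⋃ F)
  ⋃-admissible F chain adm .multiples a∈⋃ with toWitness a∈⋃
  ... | S , S∈F , a∈S = multiples (adm S∈F) a∈S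
  -- The chain may be empty, so the empty sum is bounded directly.
  ⋃-admissible F chain adm .bounded {[]} [] [] = zero-⊑ (just x)
  ⋃-admissible F chain adm .bounded {k ∷ K} K! K⊆@(k∈⋃ ∷ _) with toWitness k∈⋃
  ... | S₀ , S₀∈F , _ with chain-absorbs-finite chain S₀∈F K⊆
  ...   | S , S∈F , K⊆S = bounded (adm S∈F) K! K⊆S
  ⋃-admissible F chain adm .saturated a∈⋃ add with toWitness a∈⋃
  ... | S , S∈F , a∈S = saturated (adm S∈F) a∈S (Addable-antitone (just _) (⊆-⋃ {F} S∈F) add)

  insert-admissible : ∀ {S a} → Admissible S → HypermeagerMultiple a →
    Addable (just a) S → ¬ Addable (just a ⊞ just a) S → Admissible (insert a S)
  insert-admissible adm mult add ¬add² .multiples b∈ with toWitness b∈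
  ... | inj₁ b∈S  = multiples adm b∈S
  ... | inj₂ refl = mult
  insert-admissible adm mult add ¬add² .bounded K! K⊆ with insert-split K! K⊆
  ... | inj₁ K⊆S                   = bounded adm K! K⊆S
  ... | inj₂ (K′ , K↭ , K′! , K′⊆) = subst (_⊑ just x) (sym (⨁-↭ K↭)) (add K′ K′! K′⊆)
  insert-admissible {S} {a} adm mult add ¬add² .saturated b∈ add′ with toWitness b∈
  ... | inj₁ b∈S  = saturated adm b∈S (Addable-antitone (just _) (⊆-insert {a} {S}) add′)
  -- Saturation of `S` and `add` exclude `a` from `S`, so `a ∷ K` has no repetitions. Adding `a` to
  -- it would add `a` twice to `K`.
  ... | inj₂ refl = ¬add² λ K K! K⊆S →
    subst (_⊑ just x) (sym (⊞-assoc (just a) (just a) (⨁ K)))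
      (add′ (a ∷ K) (All.map (λ c∈S → λ { refl → saturated adm c∈S add }) K⊆S ∷ K!)
        (fromWitness (inj₂ refl) ∷ All.map (⊆-insert {a} {S}) K⊆S))

  open Zorn Admissible ⋃-admissible

  -- The Archimedean bound on multiples of `z` stops the doubling at an addable `n`-fold multiple
  -- `a` whose double is not addable.
  extendable : Archimedean → ∀ {S z} → Admissible S → Hypermeager z → z ≢ 0# →
    Addable (just z) S → Extendable S
  extendable arch {S} {z} adm hyper z≢0 add with arch z z≢0
  ... | N , _ , _ , N-max
    with doubling-fails em {λ k → Addable (⨁ (replicate k z)) S} N
           (λ k add-k → N-max k (⊑-Is-just (Addable-⊑ add-k))) 1 ℕ.≤-refl
           (subst (λ m → Addable m S) (sym (⊞-identityʳ (just z))) add)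
  ...   | n , add-n , ¬add-2n with Is-just⇒≡ (⊑-Is-just (Addable-⊑ add-n))
  ...     | a , nz = a , (λ a∈S → saturated adm a∈S add-a) ,
    insert-admissible adm (z , n , hyper , nz) add-a λ add² → ¬add-2n
      (subst (λ m → Addable m S) (sym 2nz) add²)
    where
    2nz : ⨁ (replicate (n + n) z) ≡ just a ⊞ just a
    2nz = trans (cong ⨁ (replicate-+ n n z)) (trans (⨁-++ (replicate n z) _) (cong₂ _⊞_ nz nz))

    add-a : Addable (just a) S
    add-a = subst (λ m → Addable m S) nz add-n

  Below-hypermeager : Pred Carrier ℓ
  Below-hypermeager y = ∃[ z ] z ≤ y × Hypermeager z × z ≢ 0#

  -- Any common lower bound of `y` and `y ′` is hypermeager, with witness `y`. If all of these
  -- vanish, then `y` is sharp, hence zero.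
  meager⇒hypermeager-below : ∀ {y} → (Sharp y → y ≡ 0#) → y ≢ 0# → Below-hypermeager y
  meager⇒hypermeager-below {y} meager y≢0 = decidable-stable em λ none →
    y≢0 (meager (just-⊑⇒≤ (zero-⊑ _) , just-⊑⇒≤ (zero-⊑ _) , λ z z≤y z≤y′ →
      subst (_≤ 0#) (sym (decidable-stable em λ z≢0 → none (z , z≤y , (y , z≤y , z≤y′) , z≢0)))
        (just-⊑⇒≤ (zero-⊑ _))))

  Members : Subset → Pred Carrier ℓ
  Members S a = Lift ℓ (T (S a))

  members-of : ∀ {S K} → All (T ∘ S) K → ∃[ L ] map (elements (Members S)) L ≡ K
  members-of []           = [] , refl
  members-of (_∷_ {a} a∈S K⊆S) with members-of K⊆S
  ... | L , refl = (a , [ lift a∈S ]) ∷ L , refl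

  member : ∀ {S} (e : Refinement Carrier (Members S)) → T (S (value e))
  -- The irrelevant membership proof is recovered by deciding membership.
  member (a , [ a∈S ]) = lower (recompute em a∈S)

  module _ {S} (adm : Admissible S) where

    members-bounded : ∀ {K} → Unique K → ⨁ (map (elements (Members S)) K) ⊑ just x
    -- Irrelevance of membership proofs makes `value` injective, so distinct indices carry distinct
    -- elements.
    members-bounded {K} K! = bounded adm (map⁺ (λ { refl → refl }) K!) (All.map⁺ (All.universal member K))

    maximal-orthosum : Archimedean → W+ → Meager x → ¬ Extendable S → IsOrthosum (elements (Members S)) x
    maximal-orthosum arch w+ meager ¬ext = orth , upper , least
      where
      orth : Orthogonal (elements (Members S))
      orth K K! = ⊑-Is-just (members-bounded K!)

      upper : UpperBound (FiniteSums (elements (Members S))) x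
      upper a (K , K! , eq) = just-⊑⇒≤ (subst (_⊑ just x) eq (members-bounded K!))

      least : ∀ u → UpperBound (FiniteSums (elements (Members S))) u → x ≤ u
      least u bound with w+ (Members S) orth x u upper bound
      ... | w , w-bound , (y , w⊕y) , w≤u = subst (_≤ u) w≡x w≤u
        where
        addable : ∀ {z} → z ≤ y → Addable (just z) S
        addable {z} z≤y K K! K⊆S with members-of K⊆S
        ... | L , refl with Is-just⇒≡ (⊑-Is-just (bounded adm K! K⊆S))
        -- Since `z ≤ y` and `s ≤ w`, the sum of `z` and `s` divides `y ⊕ w`, which is `x`.
        ...   | s , eq = subst (just z ⊞ ⨁ K ⊑_) (trans (⊞-comm (just y) (just w)) w⊕y)
          (⊞-mono-⊑ (≤⇒⊑ z≤y)
            (subst (_⊑ just w) (sym eq) (≤⇒⊑ (w-bound s (L , map⁻ K! , eq)))))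

        y≡0 : y ≡ 0#
        y≡0 = decidable-stable em λ y≢0 →
          -- As `y` lies below the meager `x`, it can be sharp only if it is zero.
          let z , z≤y , hyper , z≢0 = meager⇒hypermeager-below
                (λ sharp → meager y sharp (w , ⊕-comm w⊕y)) y≢0
          in ¬ext (extendable arch adm hyper z≢0 (addable z≤y))

        w≡x : w ≡ x
        w≡x = just-injective (trans (sym (⊕-identityʳ w)) (subst (λ t → w ⊕ t ≡ just x) y≡0 w⊕y))

-- The system of hypermeager elements

proposition3p4 : (∀ {a} → ExcludedMiddle a) →
    (∀ {a b} → Extensionality a b) →
    ∀ {ℓ : Level} (E : EffectAlgebra ℓ) →
    let open EffectAlgebra E in
    Archimedean → W+ →
    ∀ (x : Carrier) → Meager x →
    Σ[ H ∈ Set ℓ ] Σ[ g ∈ (H → Carrier) ]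
    ((∀ κ → Hypermeager (g κ)) × IsOrthosum g x)
proposition3p4 em ext E arch w+ x meager =
  Copies , copy , (λ κ → proj₁ (proj₂ (proj₂ (multiple (proj₁ κ))))) ,
  split-orthosum (maximal-orthosum admissible arch w+ meager ¬extendable)
  where
  open EffectAlgebra E
  open Construction em ext E x
  open MaximalSubsets em ext Carrier
  open Zorn Admissible ⋃-admissible

  M = proj₁ maximal
  admissible = proj₁ (proj₂ maximal)
  ¬extendable = proj₂ (proj₂ maximal)

  multiple : (e : Refinement Carrier (Members M)) → HypermeagerMultiple (value e)
  multiple e = Admissible.multiples admissible (member e)

  open Sums.Splitting E em (elements (Members M)) (proj₁ ∘ multiple)
    (λ e → proj₁ (proj₂ (multiple e))) (λ e → proj₂ (proj₂ (proj₂ (multiple e))))
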